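{- Let $f$ be a non-degenerate Boolean function with variable set $X$ (base variables), let $g$ be a simple extension of $f$ with set $Y$ of extension variables, and let $G$ be an optimal circuit for $g$. Then $G$ has a total $Y$-tree decomposition.
   Context: Circuits: single-sink DAGs over fan-in-2 $\land,\lor$ gates and fan-in-1 $\neg$ gates, with sources labelled by variables or constants; the size $|C|$ is the number of binary gates ($\mu_{\mathcal D}$, DeMorgan basis), and $CC(h)$ is the minimum size of a circuit computing $h$. A circuit computing $h$ is optimal if its size is $CC(h)$ and it is normalized: it is constant-free or a single constant, every gate has a path to the output, no sub-circuit matches the left-hand side of one of the rules $0\land\gamma\to 0$, $1\land\gamma\to\gamma$, $1\lor\gamma\to 1$, $0\lor\gamma\to\gamma$, $\gamma\land\neg\gamma\to0$, $\gamma\lor\neg\gamma\to1$, $\gamma\land\gamma\to\gamma$, $\gamma\lor\gamma\to\gamma$ (and their symmetric versions), $\neg\neg\gamma\to\gamma$, $\neg0\to1$, $\neg1\to0$, and every non-$\neg$ node feeds at most one $\neg$ gate. A Boolean function is non-degenerate if it depends on all its variables. Simple extension: for a non-degenerate $f$ on $n$ variables, a simple extension of $f$ is $f$ itself or a function $g$ on $n+m$ variables such that $g$ is non-degenerate, $CC(g)=CC(f)+m$, and there is a key $k\in\{0,1\}^m$ with $g(x,k)=f(x)$ for all $x\in\{0,1\}^n$. The first $n$ variables of $g$ are the base variables, the remaining $m$ are the extension variables. $Y$-tree decomposition: let $G$ be a circuit with two distinguished sets of inputs, base variables $X$ and extension variables $Y$. A triple $\langle\delta,b,T\rangle$, where $\delta$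 (a combiner) is a binary gate of $G$, the bit $b\in\{0,1\}$ designates an input of $\delta$, and $T$ is a sub-circuit of $G$ rooted at the $b$-child of $\delta$, is admissible if: (1) $T$ is a read-once formula in only extension variables; (2) $T$ is isolated in $G$: $\delta$ is the unique gate (outside $T$) reading from $T$, and it reads only the root of $T$; (3) the sub-circuit of $G$ rooted at the other ($\neg b$) child of $\delta$ contains at least one variable of $X$. A $Y$-tree decomposition of $G$ is a set of admissible triples that is non-intersecting, i.e. each $y_i\in Y$ appears in at most one $T$. Its weight is the number of extension variables read in some $T$. It is total if its weight is $|Y|$, i.e. every extension variable appears in some $T$.
   Formalization: The set X of base variables is assumed non-empty: for X empty the claim fails, e.g. f constant and g = (y1∧y2)∨(¬y1∧y3), where CC(g) = 3 = CC(f)+3 but no triple can satisfy condition (3). -}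

module Defs where

open import Data.Bool using (Bool; true; false; not; _∧_; _∨_; if_then_else_)
open import Data.Fin using (Fin; _↑ˡ_; _↑ʳ_)
open import Data.Fin.Induction using (spo-wellFounded)
open import Data.Fin.Subset using (Subset; ∣_∣)
open import Data.List using (List; []; _∷_)
open import Data.List.Membership.Propositional using (_∈_)
open import Data.List.Relation.Unary.Any using (here; there)
open import Data.Nat using (ℕ; _+_; _≤_)
open import Data.Product using (Σ; ∃; _×_; _,_; proj₁)
open import Data.Sum using (_⊎_)
open import Data.Vec using (Vec; lookup; tabulate; _++_; _[_]≔_)
open import Induction.WellFounded using (Acc; acc; WellFounded)
open import Relation.Binary.Construct.Closure.ReflexiveTransitive using (Star)
open import Relation.Binary.Construct.Closure.Transitive using (TransClosure; transitive)
open import Relation.Binary.PropositionalEquality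
  using (_≡_; _≢_; refl; isEquivalence; subst)
open import Relation.Nullary using (¬_)

BoolFun : ℕ → Set
BoolFun n = Vec Bool n → Bool

DependsOn : ∀ {n} → BoolFun n → Fin n → Set
DependsOn f i = ∃ λ x → f (x [ i ]≔ false) ≢ f (x [ i ]≔ true)

NonDegenerate : ∀ {n} → BoolFun n → Set
NonDegenerate f = ∀ i → DependsOn f i

data BinOp : Set where
  and or : BinOp

⟦_⟧ : BinOp → Bool → Bool → Bool
⟦ and ⟧ = _∧_
⟦ or  ⟧ = _∨_

data Label (n N : ℕ) : Set where
  var   : Fin n → Label n N
  const : Bool → Label n N
  neg   : Fin N → Label n N
  bin   : BinOp → Fin N → Fin N → Label n N

inputs : ∀ {n N} → Label n N → List (Fin N)
inputs (var _)     = []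
inputs (const _)   = []
inputs (neg a)     = a ∷ []
inputs (bin _ a b) = a ∷ b ∷ []

record Graph (n : ℕ) : Set where
  field
    nodes : ℕ
    label : Fin nodes → Label n nodes

  Node : Set
  Node = Fin nodes

  infix 4 _◂_ _◂⁺_ _◂*_

  -- i ◂ p: node p reads node i.  A proof is a wire from i to p, so a gate
  -- with both inputs equal to i receives two distinct wires from i.
  _◂_ _◂⁺_ _◂*_ : Node → Node → Set
  i ◂ p = i ∈ inputs (label p)
  _◂⁺_ = TransClosure _◂_
  _◂*_ = Star _◂_

  IsSink : Node → Set
  IsSink i = ∀ p → ¬ (i ◂ p)

-- Distinct sources may carry the same variable.
record Circuit (n : ℕ) : Set where
  field
    graph : Graph n

  open Graph graph public

  field
    acyclic     : ∀ i → ¬ (i ◂⁺ i)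
    output      : Node
    output-sink : IsSink output
    single-sink : ∀ i → IsSink i → i ≡ output

  ◂⁺-wellFounded : WellFounded _◂⁺_
  ◂⁺-wellFounded = spo-wellFounded record
    { isEquivalence = isEquivalence
    ; irrefl        = λ { {i} refl → acyclic i }
    ; trans         = transitive _◂_
    ; <-resp-≈      = (λ {i} → subst (i ◂⁺_)) , (λ {i} → subst (_◂⁺ i))
    }

  evalLabel : Vec Bool n → (l : Label n nodes) →
              (∀ j → j ∈ inputs l → Bool) → Bool
  evalLabel x (var v)      val = lookup x v
  evalLabel x (const b)    val = b
  evalLabel x (neg a)      val = not (val a (here refl))
  evalLabel x (bin op a b) val =
    ⟦ op ⟧ (val a (here refl)) (val b (there (here refl)))

  evalAcc : Vec Bool n → (i : Node) → Acc _◂⁺_ i → Bool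
  evalAcc x i (acc rs) =
    evalLabel x (label i) (λ j j◂i → evalAcc x j (rs TransClosure.[ j◂i ]))

  eval : BoolFun n
  eval x = evalAcc x output (◂⁺-wellFounded output)

  isBinary : Label n nodes → Bool
  isBinary (bin _ _ _) = true
  isBinary _           = false

  binaryGates : Subset nodes
  binaryGates = tabulate (λ i → isBinary (label i))

  size : ℕ
  size = ∣ binaryGates ∣

  -- The nodes of the sub-circuit rooted at r.
  Sub : Node → Node → Set
  Sub r i = i ◂* r

  -- The sub-circuit rooted at p matches the left-hand side of a rule.  Each of
  -- the operations ∧, ∨ has a rule for each constant on each side, so the
  -- first two constructors cover 0∧γ, 1∧γ, 1∨γ, 0∨γ and their mirror images.
  -- The two occurrences of γ in a rule are the same node.
  data Redex (p : Node) : Set where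
    constˡ  : ∀ {op a c b} → label p ≡ bin op a c → label a ≡ const b → Redex p
    constʳ  : ∀ {op a c b} → label p ≡ bin op a c → label c ≡ const b → Redex p
    γ-op-¬γ : ∀ {op a c} → label p ≡ bin op a c → label c ≡ neg a → Redex p
    ¬γ-op-γ : ∀ {op a c} → label p ≡ bin op a c → label a ≡ neg c → Redex p
    γ-op-γ  : ∀ {op a} → label p ≡ bin op a a → Redex p
    ¬¬γ     : ∀ {a c} → label p ≡ neg a → label a ≡ neg c → Redex p
    ¬const  : ∀ {a b} → label p ≡ neg a → label a ≡ const b → Redex p

  record Normalized : Set where
    field
      constants    : (∀ i b → label i ≢ const b)
                   ⊎ (nodes ≡ 1 × ∃ λ b → label output ≡ const b)
      connected    : ∀ i → i ◂* output
      irreducible  : ∀ p → ¬ Redex p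
      one-negation : ∀ i → (∀ j → label i ≢ neg j) →
                     ∀ p q → label p ≡ neg i → label q ≡ neg i → p ≡ q

Computes : ∀ {n} → Circuit n → BoolFun n → Set
Computes C h = ∀ x → Circuit.eval C x ≡ h x

-- CC h s: the minimum size of a circuit computing h is s.
CC : ∀ {n} → BoolFun n → ℕ → Set
CC {n} h s = (Σ (Circuit n) λ C → Computes C h × Circuit.size C ≡ s)
           × (∀ (C : Circuit n) → Computes C h → s ≤ Circuit.size C)

record Optimal {n} (C : Circuit n) (h : BoolFun n) : Set where
  field
    computes   : Computes C h
    minimum    : CC h (Circuit.size C)
    normalized : Circuit.Normalized C

-- The base variables are i ↑ˡ m and the extension variables n ↑ʳ j.  The case
-- m = 0 is the one where g is f itself.
record SimpleExtension {n m} (f : BoolFun n) (g : BoolFun (n + m)) : Set where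
  field
    nonDegenerate : NonDegenerate g
    complexity    : ∃ λ s → CC f s × CC g (s + m)
    key           : Vec Bool m
    restricts     : ∀ x → g (x ++ key) ≡ f x

module YTree (n m : ℕ) (G : Circuit (n + m)) where
  open Circuit G

  -- The sub-circuit T is given by its root.
  record Triple : Set where
    constructor ⟨_,_,_⟩
    field
      δ : Node
      b : Bool
      T : Node

  ReadsBase : Node → Set
  ReadsBase r = ∃ λ i → Sub r i × ∃ λ (v : Fin n) → label i ≡ var (v ↑ˡ m)

  ReadsExt : Node → Fin m → Set
  ReadsExt r y = ∃ λ i → Sub r i × label i ≡ var (n ↑ʳ y)

  record ReadOnceExtFormula (r : Node) : Set where
    field
      sources  : ∀ i → Sub r i → inputs (label i) ≡ [] →
                 ∃ λ (y : Fin m) → label i ≡ var (n ↑ʳ y)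
      fan-out  : ∀ i (u w : ∃ λ p → i ◂ p) →
                 Sub r (proj₁ u) → Sub r (proj₁ w) → u ≡ w
      readOnce : ∀ i j v → Sub r i → Sub r j →
                 label i ≡ var v → label j ≡ var v → i ≡ j

  Isolated : (r d : Node) → Set
  Isolated r d = ∀ i p → Sub r i → ¬ Sub r p → i ◂ p → p ≡ d × i ≡ r

  -- The inputs of δ designated by the bits 0 and 1 are the left and the right.
  record Admissible (t : Triple) : Set where
    open Triple t
    field
      {op}     : BinOp
      {l r}    : Node
      combiner : label δ ≡ bin op l r
      root     : T ≡ (if b then r else l)
      formula  : ReadOnceExtFormula T
      isolated : Isolated T δ
      base     : ReadsBase (if b then l else r)

  -- The list stands for the set of its members.
  record Decomposition : Set where
    field
      triples         : List Triple
      admissible      : ∀ t → t ∈ triples → Admissible t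
      nonIntersecting : ∀ y t t′ → t ∈ triples → t′ ∈ triples →
                        ReadsExt (Triple.T t) y → ReadsExt (Triple.T t′) y → t ≡ t′

  Total : Decomposition → Set
  Total D = ∀ y → ∃ λ t → t ∈ Decomposition.triples D × ReadsExt (Triple.T t) y

{-# OPTIONS --safe #-}

-- Call a node mixed if some base variable lies below it. Setting the extension
-- variables to the key turns unmixed nodes into constants, and then every
-- binary gate with an unmixed input becomes a constant or a copy of its other
-- input. Only the c binary gates with two mixed inputs survive, so c ≥ CC(f).
-- Now count wires leaving unmixed nodes. At every node,
--     #unmixed inputs + [extension source] + [two mixed inputs]
--       = [unmixed] + [binary],
-- while every unmixed node has an outgoing wire (the output is mixed), every
-- extension variable has a source, and there are CC(f) + m binary gates.
-- Summing forces equality: each unmixed node has exactly one outgoing wire and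
-- each extension variable exactly one source. Hence the unmixed nodes form
-- read-once trees, each ending in the first mixed gate above it, its combiner.
module Submission where

open import Defs
open import Algebra.Properties.CommutativeMonoid.Sum as Sum using ()
open import Data.Bool using (Bool; true; false; not; _∧_; _∨_; if_then_else_)
open import Data.Bool.Properties using (∧-comm; ∨-comm; ∨-identityʳ)
open import Data.Fin using (Fin; zero; suc; _≟_; _↑ˡ_; _↑ʳ_; splitAt)
open import Data.Fin.Properties
  using (any?; suc-injective; splitAt-↑ˡ; splitAt-↑ʳ; splitAt⁻¹-↑ˡ; splitAt⁻¹-↑ʳ)
open import Data.Fin.Subset using (∣_∣)
open import Data.List as List using (List; []; _∷_)
open import Data.List.Membership.Propositional using (_∈_)
open import Data.List.Membership.Propositional.Properties
  using (∈-map⁺; ∈-map⁻; ∈-tabulate⁺; ∈-tabulate⁻)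
open import Data.List.Relation.Unary.Any using (here; there)
open import Data.Nat using (ℕ; zero; suc; _+_; _≤_; z≤n; s≤s; NonZero)
open import Data.Nat.ListAction using () renaming (sum to sumᴸ)
open import Data.Nat.Properties
  using (+-0-commutativeMonoid; +-mono-≤; +-monoʳ-≤; +-monoˡ-≤; +-comm; +-assoc; +-identityʳ;
         +-cancelˡ-≤; +-cancelʳ-≤; m≤m+n; m≤n+m; m≤n⇒m≤1+n; ≤-trans; ≤-reflexive;
         module ≤-Reasoning)
open import Data.Product using (∃; _,_; _×_; proj₁; proj₂)
open import Data.Sum using (_⊎_; inj₁; inj₂; [_,_]′)
open import Data.Vec using (Vec; lookup; tabulate; _++_; _[_]≔_; replicate)
open import Data.Vec.Properties using (tabulate-cong; lookup-splitAt; lookup∘update′)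
open import Function using (_∘_; mk⇔)
open import Induction.WellFounded using (Acc; acc; WellFounded; wf⇒asym; module Subrelation)
open import Relation.Binary using (Decidable)
open import Relation.Binary.Construct.Closure.ReflexiveTransitive using (Star; ε; _◅_; _◅◅_)
open import Relation.Binary.Construct.Closure.Transitive as Trans using (TransClosure; [_]; _∷_)
open import Relation.Binary.PropositionalEquality
  using (_≡_; _≢_; refl; sym; trans; cong; cong₂; subst; module ≡-Reasoning)
open import Relation.Nullary using (Dec; yes; no; does; ¬_; contradiction)
open import Relation.Nullary.Decidable
  using (dec-true; dec-false; does-⇔; _×-dec_; _⊎-dec_; map′)

open Sum +-0-commutativeMonoid
  using (sum; sum-cong-≗; sum-replicate-zero; ∑-distrib-+; ∑-comm)

-- Finite sums of natural numbers.

bit : Bool → ℕ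
bit b = if b then 1 else 0

∣tabulate∣≡sum : ∀ {n} (b : Fin n → Bool) → ∣ tabulate b ∣ ≡ sum (bit ∘ b)
∣tabulate∣≡sum {zero}  b = refl
∣tabulate∣≡sum {suc n} b with b zero
... | true  = cong suc (∣tabulate∣≡sum (b ∘ suc))
... | false = ∣tabulate∣≡sum (b ∘ suc)

sum-mono-≤ : ∀ {n} {s t : Fin n → ℕ} → (∀ i → s i ≤ t i) → sum s ≤ sum t
sum-mono-≤ {zero}  s≤t = z≤n
sum-mono-≤ {suc n} s≤t = +-mono-≤ (s≤t zero) (sum-mono-≤ (s≤t ∘ suc))

-- Slack in one term cannot be made up by the others, which obey the same bound. This converts a
-- single global count into a statement about every node and every variable.
sum-mono-tight : ∀ {n} {s t : Fin n → ℕ} → (∀ i → s i ≤ t i) → sum t ≤ sum s →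
                 ∀ i → t i ≤ s i
sum-mono-tight {suc n} {s} {t} s≤t ∑t≤∑s zero =
  +-cancelʳ-≤ (sum (t ∘ suc)) _ _
    (≤-trans ∑t≤∑s (+-monoʳ-≤ (s zero) (sum-mono-≤ (s≤t ∘ suc))))
sum-mono-tight {suc n} {s} {t} s≤t ∑t≤∑s (suc i) =
  sum-mono-tight (s≤t ∘ suc)
    (+-cancelˡ-≤ (t zero) _ _ (≤-trans ∑t≤∑s (+-monoˡ-≤ _ (s≤t zero)))) i

term≤sum : ∀ {n} (t : Fin n → ℕ) i → t i ≤ sum t
term≤sum t zero    = m≤m+n _ _
term≤sum t (suc i) = ≤-trans (term≤sum (t ∘ suc) i) (m≤n+m _ _)

two-terms≤sum : ∀ {n} (t : Fin n → ℕ) {i j} → i ≢ j → t i + t j ≤ sum t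
two-terms≤sum t {zero}  {zero}  i≢j = contradiction refl i≢j
two-terms≤sum t {zero}  {suc j} i≢j = +-monoʳ-≤ (t zero) (term≤sum (t ∘ suc) j)
two-terms≤sum t {suc i} {zero}  i≢j =
  ≤-trans (≤-reflexive (+-comm (t (suc i)) _)) (two-terms≤sum t (i≢j ∘ sym))
two-terms≤sum t {suc i} {suc j} i≢j =
  ≤-trans (two-terms≤sum (t ∘ suc) (i≢j ∘ cong suc)) (m≤n+m _ _)

sum-ones : ∀ m → sum {m} (λ _ → 1) ≡ m
sum-ones zero    = refl
sum-ones (suc m) = cong suc (sum-ones m)

sum-indicator : ∀ {n} (t : Fin n → Bool) a → sum (λ i → bit (does (i ≟ a) ∧ t i)) ≡ bit (t a)
sum-indicator {suc n} t zero    = trans (cong (bit (t zero) +_) (sum-replicate-zero n)) (+-identityʳ _)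
sum-indicator {suc n} t (suc a) = sum-indicator (t ∘ suc) a

-- Double counting of incidences.

-- The pairs (p, w) with w : i ∈ as p and t i ≡ true are counted by p and by i.
module DoubleCount {P N} (as : Fin P → List (Fin N)) (t : Fin N → Bool) where

  total : List (Fin N) → ℕ
  total xs = sumᴸ (List.map (bit ∘ t) xs)

  occ : Fin N → List (Fin N) → ℕ
  occ i xs = sumᴸ (List.map (λ a → bit (does (i ≟ a) ∧ t i)) xs)

  sum-occ : ∀ xs → sum (λ i → occ i xs) ≡ total xs
  sum-occ []       = sum-replicate-zero N
  sum-occ (a ∷ xs) =
    trans (∑-distrib-+ (λ i → bit (does (i ≟ a) ∧ t i)) (λ i → occ i xs))
          (cong₂ _+_ (sum-indicator t a) (sum-occ xs))

  degree : Fin N → ℕ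
  degree i = sum (λ p → occ i (as p))

  sum-degree : sum degree ≡ sum (total ∘ as)
  sum-degree = trans (∑-comm (λ i p → occ i (as p))) (sum-cong-≗ (sum-occ ∘ as))

  self : ∀ {i} → t i ≡ true → bit (does (i ≟ i) ∧ t i) ≡ 1
  self {i} ti rewrite dec-true (i ≟ i) refl | ti = refl

  occ≥1 : ∀ {i} → t i ≡ true → ∀ {xs} → i ∈ xs → 1 ≤ occ i xs
  occ≥1 ti (here refl) = ≤-trans (≤-reflexive (sym (self ti))) (m≤m+n _ _)
  occ≥1 ti (there w)   = ≤-trans (occ≥1 ti w) (m≤n+m _ _)

  occ≤1⇒unique : ∀ {i} → t i ≡ true → ∀ {xs} → occ i xs ≤ 1 → (u w : i ∈ xs) → u ≡ w
  occ≤1⇒unique ti h (here refl) (here refl) = refl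
  occ≤1⇒unique ti h (here refl) (there w)
    with s≤s () ← ≤-trans (+-mono-≤ (≤-reflexive (sym (self ti))) (occ≥1 ti w)) h
  occ≤1⇒unique ti h (there u) (here refl)
    with s≤s () ← ≤-trans (+-mono-≤ (≤-reflexive (sym (self ti))) (occ≥1 ti u)) h
  occ≤1⇒unique ti h (there u) (there w) =
    cong there (occ≤1⇒unique ti (≤-trans (m≤n+m _ _) h) u w)

  module _ (covered : ∀ i → t i ≡ true → ∃ λ p → i ∈ as p) where

    bit≤degree : ∀ i → bit (t i) ≤ degree i
    bit≤degree i = go (t i) refl
      where
      go : ∀ b → t i ≡ b → bit b ≤ degree i
      go false _  = z≤n
      go true  ti with p , w ← covered i ti = ≤-trans (occ≥1 ti w) (term≤sum _ p)

    sum-bit≤sum-total : sum (bit ∘ t) ≤ sum (total ∘ as)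
    sum-bit≤sum-total = ≤-trans (sum-mono-≤ bit≤degree) (≤-reflexive sum-degree)

    -- Every marked `i` has degree at least one, so a total no larger than the number of marked `i`
    -- leaves degree exactly one. Pairs are compared together with their membership proof, so two
    -- occurrences in one list are excluded as well.
    tight⇒unique : sum (total ∘ as) ≤ sum (bit ∘ t) →
                   ∀ {i} → t i ≡ true → (u w : ∃ λ p → i ∈ as p) → u ≡ w
    tight⇒unique tight {i} ti (p , u) (q , w) = go (p ≟ q)
      where
      degree≤1 : degree i ≤ 1
      degree≤1 = subst (λ b → degree i ≤ bit b) ti
        (sum-mono-tight bit≤degree (≤-trans (≤-reflexive sum-degree) tight) i)

      go : Dec (p ≡ q) → (p , u) ≡ (q , w)
      go (yes refl) = cong (p ,_) (occ≤1⇒unique ti (≤-trans (term≤sum _ p) degree≤1) u w)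
      go (no p≢q) with s≤s () ← ≤-trans (+-mono-≤ (occ≥1 ti u) (occ≥1 ti w))
                                  (≤-trans (two-terms≤sum _ p≢q) degree≤1)

-- Decidable subsets of `Fin N`.

-- Nodes of a graph must form a `Fin`, so a subset of nodes is presented as one. `card-≤` later
-- bounds the number of binary gates after pruning.
record Enumeration {N} (P : Fin N → Set) : Set where
  field
    count     : ℕ
    elem      : Fin count → Fin N
    elem-∈    : ∀ i → P (elem i)
    injective : ∀ {i j} → elem i ≡ elem j → i ≡ j
    index     : ∀ p → P p → Fin count
    elem-index : ∀ p (Pp : P p) → elem (index p Pp) ≡ p
    card-≤    : ∀ (b : Fin N → Bool) → ∣ tabulate (b ∘ elem) ∣ ≤ ∣ tabulate b ∣

enumerate : ∀ {N} {P : Fin N → Set} → (∀ p → Dec (P p)) → Enumeration P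
enumerate {zero} P? = record
  { count = 0 ; elem = λ () ; elem-∈ = λ () ; injective = λ { {()} } ; index = λ ()
  ; elem-index = λ () ; card-≤ = λ _ → z≤n }
enumerate {suc N} {P} P? = extend (P? zero)
  where
  open Enumeration (enumerate (P? ∘ suc))

  extend : Dec (P zero) → Enumeration P
  extend (yes P0) = record
    { count      = suc count
    ; elem       = elem′
    ; elem-∈     = λ { zero → P0 ; (suc i) → elem-∈ i }
    ; injective  = injective′
    ; index      = λ { zero _ → zero ; (suc p) Pp → suc (index p Pp) }
    ; elem-index = λ { zero _ → refl ; (suc p) Pp → cong suc (elem-index p Pp) }
    ; card-≤     = card-≤′
    }
    where
    elem′ : Fin (suc count) → Fin (suc N)
    elem′ zero    = zero
    elem′ (suc i) = suc (elem i)

    injective′ : ∀ {i j} → elem′ i ≡ elem′ j → i ≡ j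
    injective′ {zero}  {zero}  _  = refl
    injective′ {suc _} {suc _} eq = cong suc (injective (suc-injective eq))

    card-≤′ : ∀ b → ∣ tabulate (b ∘ elem′) ∣ ≤ ∣ tabulate b ∣
    card-≤′ b with b zero
    ... | true  = s≤s (card-≤ (b ∘ suc))
    ... | false = card-≤ (b ∘ suc)
  extend (no ¬P0) = record
    { count      = count
    ; elem       = suc ∘ elem
    ; elem-∈     = elem-∈
    ; injective  = injective ∘ suc-injective
    ; index      = λ { zero P0 → contradiction P0 ¬P0 ; (suc p) Pp → index p Pp }
    ; elem-index = λ { zero P0 → contradiction P0 ¬P0 ; (suc p) Pp → cong suc (elem-index p Pp) }
    ; card-≤     = card-≤′
    }
    where
    card-≤′ : ∀ b → ∣ tabulate (b ∘ suc ∘ elem) ∣ ≤ ∣ tabulate b ∣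
    card-≤′ b with b zero
    ... | true  = m≤n⇒m≤1+n (card-≤ (b ∘ suc))
    ... | false = card-≤ (b ∘ suc)

-- Labels: renaming of inputs and local evaluation.

isBin : ∀ {n N} → Label n N → Bool
isBin (bin _ _ _) = true
isBin _           = false

relabel : ∀ {n N M} → (Fin N → Fin M) → Label n N → Label n M
relabel h (var v)      = var v
relabel h (const b)    = const b
relabel h (neg a)      = neg (h a)
relabel h (bin op a b) = bin op (h a) (h b)

-- `evalLabel` with the input values given by a plain function on nodes rather than by one that also
-- takes the wire.
valueOf : ∀ {n N} → Vec Bool n → (Fin N → Bool) → Label n N → Bool
valueOf x v (var i)      = lookup x i
valueOf x v (const b)    = b
valueOf x v (neg a)      = not (v a)
valueOf x v (bin op a b) = ⟦ op ⟧ (v a) (v b)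

inputs-relabel : ∀ {n N M} (h : Fin N → Fin M) (l : Label n N) →
                 inputs (relabel h l) ≡ List.map h (inputs l)
inputs-relabel h (var _)     = refl
inputs-relabel h (const _)   = refl
inputs-relabel h (neg _)     = refl
inputs-relabel h (bin _ _ _) = refl

isBin-relabel : ∀ {n N M} (h : Fin N → Fin M) (l : Label n N) → isBin (relabel h l) ≡ isBin l
isBin-relabel h (var _)     = refl
isBin-relabel h (const _)   = refl
isBin-relabel h (neg _)     = refl
isBin-relabel h (bin _ _ _) = refl

valueOf-relabel : ∀ {n N M} x (v : Fin M → Bool) (w : Fin N → Bool)
                  (h : Fin N → Fin M) (l : Label n N) →
                  (∀ a → a ∈ inputs l → v (h a) ≡ w a) →
                  valueOf x v (relabel h l) ≡ valueOf x w l
valueOf-relabel x v w h (var _)      eq = refl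
valueOf-relabel x v w h (const _)    eq = refl
valueOf-relabel x v w h (neg a)      eq = cong not (eq a (here refl))
valueOf-relabel x v w h (bin op a b) eq =
  cong₂ ⟦ op ⟧ (eq a (here refl)) (eq b (there (here refl)))

∈-inputs-relabel⁻ : ∀ {n N M} (h : Fin N → Fin M) (l : Label n N) {j} →
                    j ∈ inputs (relabel h l) → ∃ λ a → a ∈ inputs l × j ≡ h a
∈-inputs-relabel⁻ h l j∈ = ∈-map⁻ h (subst (_ ∈_) (inputs-relabel h l) j∈)

∈-inputs-relabel⁺ : ∀ {n N M} (h : Fin N → Fin M) (l : Label n N) {a} →
                    a ∈ inputs l → h a ∈ inputs (relabel h l)
∈-inputs-relabel⁺ h l a∈ = subst (_ ∈_) (sym (inputs-relabel h l)) (∈-map⁺ h a∈)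

-- Paths and decidable reachability.

any-∈? : ∀ {A : Set} {P : A → Set} xs → (∀ a → a ∈ xs → Dec (P a)) →
         Dec (∃ λ a → a ∈ xs × P a)
any-∈? []       P? = no λ { (_ , () , _) }
any-∈? (x ∷ xs) P? with P? x (here refl) | any-∈? xs (λ a → P? a ∘ there)
... | yes Px | _                  = yes (x , here refl , Px)
... | no _   | yes (a , a∈ , Pa)  = yes (a , there a∈ , Pa)
... | no ¬Px | no ¬Pxs            =
  no λ { (_ , here refl , Px) → ¬Px Px ; (a , there a∈ , Pa) → ¬Pxs (a , a∈ , Pa) }

unsnoc : ∀ {A : Set} {R : A → A → Set} {i k} → Star R i k → i ≡ k ⊎ ∃ λ j → Star R i j × R j k
unsnoc ε       = inj₁ refl
unsnoc (r ◅ s) with unsnoc s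
... | inj₁ refl         = inj₂ (_ , ε , r)
... | inj₂ (j , s′ , q) = inj₂ (j , r ◅ s′ , q)

Star∘R⇒TransClosure : ∀ {A : Set} {R : A → A → Set} {i j k} → Star R i j → R j k → TransClosure R i k
Star∘R⇒TransClosure ε       q = [ q ]
Star∘R⇒TransClosure (r ◅ s) q = r ∷ Star∘R⇒TransClosure s q

R∘Star⇒TransClosure : ∀ {A : Set} {R : A → A → Set} {i j k} → R i j → Star R j k → TransClosure R i k
R∘Star⇒TransClosure q ε       = [ q ]
R∘Star⇒TransClosure q (r ◅ s) = q ∷ R∘Star⇒TransClosure r s

module GraphProperties {n} (H : Graph n) (wf : WellFounded (Graph._◂_ H)) where
  open Graph H

  infix 4 _◂*?_
  -- Well-founded recursion on the target: a path to `r` is empty or ends with a wire from one of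
  -- the finitely many inputs of `r`.
  _◂*?_ : Decidable _◂*_
  j ◂*? r = go r (wf r)
    where
    go : ∀ r → Acc _◂_ r → Dec (j ◂* r)
    go r (acc rs) with j ≟ r | any-∈? (inputs (label r)) (λ a a◂r → go a (rs a◂r))
    ... | yes refl | _                   = yes ε
    ... | no _     | yes (a , a◂r , j*a) = yes (j*a ◅◅ a◂r ◅ ε)
    ... | no j≢r   | no ¬p               = no λ j*r → case-unsnoc (unsnoc j*r)
      where
      case-unsnoc : ¬ (j ≡ r ⊎ ∃ λ a → j ◂* a × a ◂ r)
      case-unsnoc (inj₁ j≡r)             = j≢r j≡r
      case-unsnoc (inj₂ (a , j*a , a◂r)) = ¬p (a , a◂r , j*a)

-- Size and evaluation of a circuit.

Circuit-isBinary : ∀ {n} (C : Circuit n) l → Circuit.isBinary C l ≡ isBin l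
Circuit-isBinary C (var _)     = refl
Circuit-isBinary C (const _)   = refl
Circuit-isBinary C (neg _)     = refl
Circuit-isBinary C (bin _ _ _) = refl

size≡ : ∀ {n} (C : Circuit n) → Circuit.size C ≡ ∣ tabulate (isBin ∘ Circuit.label C) ∣
size≡ C = cong ∣_∣ (tabulate-cong (λ i → Circuit-isBinary C (Circuit.label C i)))

module CircuitProperties {n} (C : Circuit n) where
  open Circuit C

  -- A node assignment consistent with all labels. By `evalAcc-run` it agrees with evaluation, so
  -- exhibiting one is enough to compute the output.
  IsRun : Vec Bool n → (Node → Bool) → Set
  IsRun x v = ∀ p → v p ≡ valueOf x v (label p)

  evalLabel-cong : ∀ x l {val val′ : ∀ j → j ∈ inputs l → Bool} →
                   (∀ j j∈ → val j j∈ ≡ val′ j j∈) → evalLabel x l val ≡ evalLabel x l val′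
  evalLabel-cong x (var _)      eq = refl
  evalLabel-cong x (const _)    eq = refl
  evalLabel-cong x (neg a)      eq = cong not (eq a _)
  evalLabel-cong x (bin op a b) eq = cong₂ ⟦ op ⟧ (eq a _) (eq b _)

  evalLabel≡valueOf : ∀ x v l → evalLabel x l (λ j _ → v j) ≡ valueOf x v l
  evalLabel≡valueOf x v (var _)      = refl
  evalLabel≡valueOf x v (const _)    = refl
  evalLabel≡valueOf x v (neg a)      = refl
  evalLabel≡valueOf x v (bin op a b) = refl

  evalAcc-run : ∀ {x v} → IsRun x v → ∀ p (a : Acc _◂⁺_ p) → evalAcc x p a ≡ v p
  evalAcc-run {x} {v} run p (acc rs) =
    trans (evalLabel-cong x (label p) (λ j j◂p → evalAcc-run run j (rs [ j◂p ])))
          (trans (evalLabel≡valueOf x v (label p)) (sym (run p)))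

  eval-run : ∀ {x v} → IsRun x v → eval x ≡ v output
  eval-run run = evalAcc-run run output (◂⁺-wellFounded output)

  value : Vec Bool n → Node → Bool
  value x p = evalAcc x p (◂⁺-wellFounded p)

  -- The recursion evaluates an input with an accessibility proof derived from that of its reader,
  -- while `value` starts from the canonical one; the two have to be compared.
  evalAcc-irrelevant : ∀ x p (a b : Acc _◂⁺_ p) → evalAcc x p a ≡ evalAcc x p b
  evalAcc-irrelevant x p (acc rs) (acc rs′) =
    evalLabel-cong x (label p) (λ j j◂p → evalAcc-irrelevant x j (rs [ j◂p ]) (rs′ [ j◂p ]))

  value-run : ∀ x → IsRun x (value x)
  value-run x p = go (◂⁺-wellFounded p)
    where
    go : ∀ a → evalAcc x p a ≡ valueOf x (value x) (label p)
    go (acc rs) = trans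
      (evalLabel-cong x (label p)
        (λ j j◂p → evalAcc-irrelevant x j (rs [ j◂p ]) (◂⁺-wellFounded j)))
      (evalLabel≡valueOf x (value x) (label p))

-- Cutting a well-founded graph down to the nodes below `r`.

module Prune {n} (H : Graph n) (wf : WellFounded (Graph._◂_ H)) (r : Graph.Node H) where
  open Graph H
  open GraphProperties H wf
  open Enumeration (enumerate (_◂*? r))

  -- Nodes off the sub-circuit of r are sent to the junk value index r.
  toIndex : Node → Fin count
  toIndex p with p ◂*? r
  ... | yes p*r = index p p*r
  ... | no _    = index r ε

  elem-toIndex : ∀ {p} → p ◂* r → elem (toIndex p) ≡ p
  elem-toIndex {p} p*r with p ◂*? r
  ... | yes q = elem-index p q
  ... | no ¬q = contradiction p*r ¬q

  pruned : Graph n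
  pruned = record { nodes = count ; label = relabel toIndex ∘ label ∘ elem }

  module P = Graph pruned

  elem-◂ : ∀ {i j} → i P.◂ j → elem i ◂ elem j
  elem-◂ {i} {j} i◂j with a , a◂ , refl ← ∈-inputs-relabel⁻ toIndex (label (elem j)) i◂j =
    subst (_◂ elem j) (sym (elem-toIndex (a◂ ◅ elem-∈ j))) a◂

  elem-◂⁺ : ∀ {i j} → i P.◂⁺ j → elem i ◂⁺ elem j
  elem-◂⁺ [ w ]   = [ elem-◂ w ]
  elem-◂⁺ (w ∷ s) = elem-◂ w ∷ elem-◂⁺ s

  circuit : Circuit n
  circuit = record
    { graph       = pruned
    ; acyclic     = λ i i⁺i → ◂⁺-irreflexive (elem-◂⁺ i⁺i)
    ; output      = toIndex r
    ; output-sink = λ p r◂p → ◂⁺-irreflexive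
                      (R∘Star⇒TransClosure (subst (_◂ elem p) (elem-toIndex ε) (elem-◂ r◂p)) (elem-∈ p))
    ; single-sink = λ i sink → injective (trans (only-root i sink (elem-∈ i)) (sym (elem-toIndex ε)))
    }
    where
    ◂⁺-irreflexive : ∀ {i} → ¬ (i ◂⁺ i)
    ◂⁺-irreflexive c = wf⇒asym (Trans.wellFounded _ wf) c c

    -- A node below `r` other than `r` starts a path to `r`, and the first wire of that path
    -- survives the pruning.
    only-root : ∀ i → P.IsSink i → elem i ◂* r → elem i ≡ r
    only-root i sink i*r = go i*r refl
      where
      go : ∀ {p} → p ◂* r → p ≡ elem i → p ≡ r
      go ε _ = refl
      go (_◅_ {j = q} w s) refl = contradiction wire (sink (toIndex q))
        where
        wire : i P.◂ toIndex q
        wire = subst (_∈ inputs (relabel toIndex (label (elem (toIndex q)))))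
          (injective (elem-toIndex (w ◅ s)))
          (∈-inputs-relabel⁺ toIndex (label (elem (toIndex q)))
            (subst (elem i ◂_) (sym (elem-toIndex s)) w))

  -- Consistency of `v` is asked for below `r` only, which permits `H` to carry wrong labels
  -- elsewhere.
  eval-circuit : ∀ x (v : Node → Bool) → (∀ p → p ◂* r → v p ≡ valueOf x v (label p)) →
                 Circuit.eval circuit x ≡ v r
  eval-circuit x v run = trans
    (CircuitProperties.eval-run circuit {v = v ∘ elem} λ i → trans (run (elem i) (elem-∈ i))
      (sym (valueOf-relabel x (v ∘ elem) v toIndex (label (elem i))
        λ a a◂ → cong v (elem-toIndex (a◂ ◅ elem-∈ i)))))
    (cong v (elem-toIndex ε))

  size-circuit : Circuit.size circuit ≤ ∣ tabulate (isBin ∘ label) ∣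
  size-circuit = ≤-trans (≤-reflexive (trans (size≡ circuit)
    (cong ∣_∣ (tabulate-cong (isBin-relabel toIndex ∘ label ∘ elem)))))
    (card-≤ (isBin ∘ label))

-- Fixed gate inputs and sources of variables.

var≟ : ∀ {n N} (l : Label n N) u → Dec (l ≡ var u)
var≟ (var w) u     = map′ (cong var) (λ { refl → refl }) (w ≟ u)
var≟ (const _) u   = no λ ()
var≟ (neg _) u     = no λ ()
var≟ (bin _ _ _) u = no λ ()

-- The reason a gate with a frozen input can be removed: it either passes its other input on or
-- ignores it.
neutral-or-absorbing : ∀ op c → (∀ y → ⟦ op ⟧ c y ≡ y) ⊎ (∀ y z → ⟦ op ⟧ c y ≡ ⟦ op ⟧ c z)
neutral-or-absorbing and true  = inj₁ λ _ → refl
neutral-or-absorbing and false = inj₂ λ _ _ → refl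
neutral-or-absorbing or  true  = inj₂ λ _ _ → refl
neutral-or-absorbing or  false = inj₁ λ _ → refl

⟦⟧-comm : ∀ op x y → ⟦ op ⟧ x y ≡ ⟦ op ⟧ y x
⟦⟧-comm and = ∧-comm
⟦⟧-comm or  = ∨-comm

-- A list of length at most one, so that sources of extension variables are counted by the same
-- double count as wires.
extVars : ∀ n {m N} → Label (n + m) N → List (Fin m)
extVars n (var u) = [ (λ _ → []) , (λ y → y ∷ []) ]′ (splitAt n u)
extVars n _       = []

extVars-var : ∀ n {m N} y → y ∈ extVars n {m} {N} (var (n ↑ʳ y))
extVars-var n {m} y rewrite splitAt-↑ʳ n m y = here refl

does⇒ : ∀ {A : Set} (a? : Dec A) → does a? ≡ true → A
does⇒ (yes a) _ = a

module SourceExists {n} (C : Circuit n) where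
  open Circuit C
  open CircuitProperties C

  -- If no node carries `u`, the node values for `u` false are also a run for `u` true, so the two
  -- outputs agree.
  dependsOn⇒source : ∀ u → DependsOn eval u → ∃ λ p → label p ≡ var u
  dependsOn⇒source u (x , differ) with any? (λ p → var≟ (label p) u)
  ... | yes source = source
  ... | no ¬source = contradiction (sym (eval-run run)) differ
    where
    valueOf-update : ∀ v l → l ≢ var u →
      valueOf (x [ u ]≔ false) v l ≡ valueOf (x [ u ]≔ true) v l
    valueOf-update v (var w)      w≢u =
      trans (lookup∘update′ (w≢u ∘ cong var) x false) (sym (lookup∘update′ (w≢u ∘ cong var) x true))
    valueOf-update v (const _)    _   = refl
    valueOf-update v (neg _)      _   = refl
    valueOf-update v (bin _ _ _)  _   = refl

    run : IsRun (x [ u ]≔ true) (value (x [ u ]≔ false))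
    run p = trans (value-run _ p) (valueOf-update _ (label p) (λ eq → ¬source (p , eq)))

-- Mixed and unmixed nodes.

module Mixed (n m : ℕ) (G : Circuit (n + m)) where
  open Circuit G
  open YTree n m G

  ◂-wellFounded : WellFounded _◂_
  ◂-wellFounded = Trans.wellFounded⁻ _◂_ ◂⁺-wellFounded

  open GraphProperties graph ◂-wellFounded
  open CircuitProperties G

  IsBase : Label (n + m) nodes → Set
  IsBase l = ∃ λ (v : Fin n) → l ≡ var (v ↑ˡ m)

  ReadsBase? : ∀ r → Dec (ReadsBase r)
  ReadsBase? r = any? λ i → (i ◂*? r) ×-dec any? (λ v → var≟ (label i) (v ↑ˡ m))

  mixed : Node → Bool
  mixed r = does (ReadsBase? r)

  readsBase-mono : ∀ {a p} → a ◂* p → ReadsBase a → ReadsBase p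
  readsBase-mono s (i , t , base) = i , t ◅◅ s , base

  readsBase⁻ : ∀ {p} → ReadsBase p → IsBase (label p) ⊎ ∃ λ a → a ◂ p × ReadsBase a
  readsBase⁻ (i , s , base) with unsnoc s
  ... | inj₁ refl        = inj₁ base
  ... | inj₂ (a , t , w) = inj₂ (a , w , i , t , base)

  mixedLabel : Label (n + m) nodes → Bool
  mixedLabel (var u)      = [ (λ _ → true) , (λ _ → false) ]′ (splitAt n u)
  mixedLabel (const _)    = false
  mixedLabel (neg a)      = mixed a
  mixedLabel (bin _ a b)  = mixed a ∨ mixed b

  -- Replaces reachability by a rule on the label and its inputs, so that the counting identity can
  -- be checked one node at a time.
  mixed-label : ∀ p → mixed p ≡ mixedLabel (label p)
  mixed-label p = go (label p) refl
    where
    step : ∀ {a l} → label p ≡ l → a ∈ inputs l → ReadsBase a → ReadsBase p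
    step eq a∈ = readsBase-mono (subst (λ l → _ ∈ inputs l) (sym eq) a∈ ◅ ε)

    unstep : ∀ {l} → label p ≡ l → ReadsBase p → IsBase l ⊎ ∃ λ a → a ∈ inputs l × ReadsBase a
    unstep refl = readsBase⁻

    go : ∀ l → label p ≡ l → mixed p ≡ mixedLabel l
    go (var u) eq with splitAt n u in split
    ... | inj₁ v = dec-true (ReadsBase? p)
      (p , ε , v , trans eq (cong var (sym (splitAt⁻¹-↑ˡ split))))
    ... | inj₂ y = dec-false (ReadsBase? p) λ base → impossible (unstep eq base)
      where
      impossible : ¬ (IsBase (var u) ⊎ ∃ λ a → a ∈ [] × ReadsBase a)
      impossible (inj₁ (v , refl)) with () ← trans (sym split) (splitAt-↑ˡ n v m)
    go (const b) eq = dec-false (ReadsBase? p) λ base → impossible (unstep eq base)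
      where
      impossible : ¬ (IsBase (const b) ⊎ ∃ λ a → a ∈ [] × ReadsBase a)
      impossible (inj₁ (_ , ()))
    go (neg a) eq = does-⇔ (mk⇔ to (step eq (here refl))) (ReadsBase? p) (ReadsBase? a)
      where
      to : ReadsBase p → ReadsBase a
      to base with inj₂ (_ , here refl , base′) ← unstep eq base = base′
    go (bin op a b) eq = does-⇔
      (mk⇔ to [ step eq (here refl) , step eq (there (here refl)) ]′)
      (ReadsBase? p) (ReadsBase? a ⊎-dec ReadsBase? b)
      where
      to : ReadsBase p → ReadsBase a ⊎ ReadsBase b
      to base with unstep eq base
      ... | inj₂ (_ , here refl , base′)         = inj₁ base′
      ... | inj₂ (_ , there (here refl) , base′) = inj₂ base′

  mixed-mono : ∀ {i p} → i ◂* p → mixed i ≡ true → mixed p ≡ true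
  mixed-mono {i} {p} s mi = dec-true (ReadsBase? p) (readsBase-mono s (does⇒ (ReadsBase? i) mi))

  unmixed-anti : ∀ {i p} → i ◂* p → mixed p ≡ false → mixed i ≡ false
  unmixed-anti {i} s mp with mixed i in mi
  ... | false = refl
  ... | true with () ← trans (sym mp) (mixed-mono s mi)

  -- Marks the gates that survive when the extension variables are fixed.
  inner : Label (n + m) nodes → Bool
  inner (bin _ a b) = mixed a ∧ mixed b
  inner _           = false

  -- Fixing the extension variables to `k`.

  module Restriction (k : Vec Bool m) where

    val : Vec Bool n → Node → Bool
    val x = value (x ++ k)

    val-run : ∀ x {p l} → label p ≡ l → val x p ≡ valueOf (x ++ k) (val x) l
    val-run x {p} refl = value-run (x ++ k) p

    -- Every source below an unmixed node is a constant or an extension variable, and the latter are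
    -- fixed by `k`.
    unmixed-val : ∀ {p} → mixed p ≡ false → ∀ x x′ → val x p ≡ val x′ p
    unmixed-val {p} mp x x′ = go p (◂-wellFounded p) mp
      where
      lookup-ext : ∀ u → mixedLabel (var u) ≡ false → lookup (x ++ k) u ≡ lookup (x′ ++ k) u
      lookup-ext u mu = trans (lookup-splitAt n x k u)
        (trans (same mu) (sym (lookup-splitAt n x′ k u)))
        where
        same : mixedLabel (var u) ≡ false →
               [ lookup x , lookup k ]′ (splitAt n u) ≡ [ lookup x′ , lookup k ]′ (splitAt n u)
        same mu with inj₂ y ← splitAt n u = refl

      go : ∀ p → Acc _◂_ p → mixed p ≡ false → val x p ≡ val x′ p
      go p (acc rs) mp = by-label (label p) refl
        where
        input : ∀ {a} → a ◂ p → val x a ≡ val x′ a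
        input {a} w = go a (rs w) (unmixed-anti (w ◅ ε) mp)

        by-label : ∀ l → label p ≡ l → val x p ≡ val x′ p
        by-label l eq = trans (val-run x eq) (trans (equal l eq) (sym (val-run x′ eq)))
          where
          equal : ∀ l → label p ≡ l → valueOf (x ++ k) (val x) l ≡ valueOf (x′ ++ k) (val x′) l
          equal (var u)      eq =
            lookup-ext u (trans (sym (trans (mixed-label p) (cong mixedLabel eq))) mp)
          equal (const b)    eq = refl
          equal (neg a)      eq = cong not (input (subst (λ l → a ∈ inputs l) (sym eq) (here refl)))
          equal (bin op a b) eq = cong₂ ⟦ op ⟧
            (input (subst (λ l → a ∈ inputs l) (sym eq) (here refl)))
            (input (subst (λ l → b ∈ inputs l) (sym eq) (there (here refl))))

    -- The all-false base input is an arbitrary choice: the value is relied on only at nodes where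
    -- it is the same for all base inputs.
    const-val : Node → Bool
    const-val = val (replicate n false)

    -- A binary gate with an unmixed input becomes a constant; this is wrong for
    -- a gate that equals its other input, and such a gate will be bypassed.
    coreLabel : Node → Label (n + m) nodes → Label n nodes
    coreLabel p (var u)      = [ var , const ∘ lookup k ]′ (splitAt n u)
    coreLabel p (const b)    = const b
    coreLabel p (neg a)      = neg a
    coreLabel p (bin op a b) = if mixed a ∧ mixed b then bin op a b else const (const-val p)

    core : Node → Label n nodes
    core p = coreLabel p (label p)

    isBin-core : ∀ p l → isBin (coreLabel p l) ≡ inner l
    isBin-core p (var u) with splitAt n u
    ... | inj₁ _ = refl
    ... | inj₂ _ = refl
    isBin-core p (const _)    = refl
    isBin-core p (neg _)      = refl
    isBin-core p (bin op a b) with mixed a ∧ mixed b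
    ... | true  = refl
    ... | false = refl

    inputs-core : ∀ p l {a} → a ∈ inputs (coreLabel p l) → a ∈ inputs l
    inputs-core p (var u) a∈ with splitAt n u
    inputs-core p (var u) () | inj₁ _
    inputs-core p (var u) () | inj₂ _
    inputs-core p (neg _) a∈ = a∈
    inputs-core p (bin op a b) a∈ with mixed a ∧ mixed b
    ... | true = a∈

    -- The core label of `p` gives the right value, so `p` may occur in the restricted circuit.
    Kept : Node → Set
    Kept p = ∀ x → val x p ≡ valueOf x (val x) (core p)

    -- The only real case is a gate with an unmixed input, whose value is fixed. If that value is
    -- neutral the gate copies its other input; if absorbing, the gate is constant and `const-val p`
    -- is correct.
    kept-or-copy : ∀ p → Kept p ⊎ ∃ λ a → a ◂ p × ∀ x → val x a ≡ val x p
    kept-or-copy p = go (label p) refl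
      where
      x₀ = replicate n false

      go : ∀ l → label p ≡ l → (∀ x → val x p ≡ valueOf x (val x) (coreLabel p l))
                             ⊎ ∃ λ a → a ∈ inputs l × ∀ x → val x a ≡ val x p
      go (var u) eq = inj₁ λ x → trans (val-run x eq) (trans (lookup-splitAt n x k u) (split x))
        where
        split : ∀ x → [ lookup x , lookup k ]′ (splitAt n u)
                    ≡ valueOf x (val x) ([ var , const ∘ lookup k ]′ (splitAt n u))
        split x with splitAt n u
        ... | inj₁ _ = refl
        ... | inj₂ _ = refl
      go (const b) eq = inj₁ λ x → val-run x eq
      go (neg a)   eq = inj₁ λ x → val-run x eq
      go (bin op a b) eq with mixed a in ma | mixed b in mb
      ... | true  | true = inj₁ λ x → val-run x eq
      ... | false | _ with neutral-or-absorbing op (const-val a)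
      ...   | inj₁ neutral   = inj₂ (b , there (here refl) , λ x → sym (trans (val-run x eq)
                (trans (cong (λ c → ⟦ op ⟧ c (val x b)) (unmixed-val ma x x₀)) (neutral _))))
      ...   | inj₂ absorbing = inj₁ λ x → trans (val-run x eq)
                (trans (cong (λ c → ⟦ op ⟧ c (val x b)) (unmixed-val ma x x₀))
                (trans (absorbing _ _) (sym (val-run x₀ eq))))
      go (bin op a b) eq | true | false with neutral-or-absorbing op (const-val b)
      ...   | inj₁ neutral   = inj₂ (a , here refl , λ x → sym (trans (val-run x eq)
                (trans (cong (⟦ op ⟧ (val x a)) (unmixed-val mb x x₀))
                (trans (⟦⟧-comm op _ _) (neutral _)))))
      ...   | inj₂ absorbing = inj₁ λ x → trans (val-run x eq)
                (trans (cong (⟦ op ⟧ (val x a)) (unmixed-val mb x x₀))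
                (trans (⟦⟧-comm op _ _) (trans (absorbing _ _)
                (trans (⟦⟧-comm op _ _) (sym (val-run x₀ eq))))))

    -- A chain of copies descends along wires, hence ends at a kept node.
    bypass : ∀ p → ∃ λ q → q ◂* p × Kept q × (∀ x → val x q ≡ val x p)
    bypass p = go p (◂-wellFounded p)
      where
      go : ∀ p → Acc _◂_ p → ∃ λ q → q ◂* p × Kept q × (∀ x → val x q ≡ val x p)
      go p (acc rs) with kept-or-copy p
      ... | inj₁ kept = p , ε , kept , λ _ → refl
      ... | inj₂ (a , w , copy) with q , s , kept , same ← go a (rs w) =
        q , s ◅◅ w ◅ ε , kept , λ x → trans (same x) (copy x)

    β : Node → Node
    β p = proj₁ (bypass p)

    kept-β : ∀ p → Kept (β p)
    kept-β p = proj₁ (proj₂ (proj₂ (bypass p)))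

    val-β : ∀ p x → val x (β p) ≡ val x p
    val-β p = proj₂ (proj₂ (proj₂ (bypass p)))

    restricted : Graph n
    restricted = record { nodes = nodes ; label = relabel β ∘ core }

    module R = Graph restricted

    -- A redirected wire stands for a nonempty path of `G`, so the restricted graph inherits
    -- well-foundedness.
    restricted-◂⁺ : ∀ {i p} → i R.◂ p → i ◂⁺ p
    restricted-◂⁺ {i} {p} w with a , a∈ , refl ← ∈-inputs-relabel⁻ β (core p) w =
      Star∘R⇒TransClosure (proj₁ (proj₂ (bypass a))) (inputs-core p (label p) a∈)

    restricted-wellFounded : WellFounded R._◂_
    restricted-wellFounded = Subrelation.wellFounded restricted-◂⁺ ◂⁺-wellFounded

    -- All wires of the restricted graph start in the image of `β`, so the wrongly labelled nodes
    -- are never reached from its output.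
    kept-reachable : ∀ {p r} → p R.◂* β r → Kept p
    kept-reachable {r = r} ε = kept-β r
    kept-reachable (_◅_ {j = q} w s) with a , _ , refl ← ∈-inputs-relabel⁻ β (core q) w = kept-β a

    open Prune restricted restricted-wellFounded (β output) public using (circuit)
    open Prune restricted restricted-wellFounded (β output) using (eval-circuit; size-circuit)

    eval-restricted : ∀ x → Circuit.eval circuit x ≡ eval (x ++ k)
    eval-restricted x = trans
      (eval-circuit x (val x) λ p s → trans (kept-reachable s x)
        (sym (valueOf-relabel x (val x) (val x) β (core p) (λ a _ → val-β a x))))
      (val-β output x)

    -- Core labels are binary exactly at inner gates, and pruning can only lose gates.
    size-restricted : Circuit.size circuit ≤ sum (bit ∘ inner ∘ label)
    size-restricted = ≤-trans size-circuit (≤-reflexive (trans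
      (∣tabulate∣≡sum (isBin ∘ relabel β ∘ core))
      (sum-cong-≗ λ p → cong bit (trans (isBin-relabel β (core p)) (isBin-core p (label p))))))

-- The wire count.

-- Arithmetic of the count, with `a` wires leaving the `a′` unmixed nodes, `b` extension sources,
-- `c` inner gates, `d` binary gates and `s` the complexity of `f`. The lower bounds for `a`, `b`,
-- `c` already add up to the upper bound for `a′ + d`, so none has slack.
squeeze : ∀ {a a′ b c d m s} → a′ ≤ a → m ≤ b → s ≤ c → d ≤ s + m →
          a + b + c ≡ a′ + d → a ≤ a′ × b ≤ m
squeeze {a} {a′} {b} {c} {d} {m} {s} a′≤a m≤b s≤c d≤s+m eq =
  +-cancelʳ-≤ (m + s) _ _ (begin
    a + (m + s)  ≤⟨ +-monoʳ-≤ a (+-mono-≤ m≤b s≤c) ⟩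
    a + (b + c)  ≤⟨ bound ⟩
    a′ + (m + s) ∎) ,
  +-cancelʳ-≤ s _ _ (+-cancelˡ-≤ a′ _ _ (begin
    a′ + (b + s) ≤⟨ +-mono-≤ a′≤a (+-monoʳ-≤ b s≤c) ⟩
    a + (b + c)  ≤⟨ bound ⟩
    a′ + (m + s) ∎))
  where
  open ≤-Reasoning
  bound : a + (b + c) ≤ a′ + (m + s)
  bound = begin
    a + (b + c)  ≡⟨ +-assoc a b c ⟨
    a + b + c    ≡⟨ eq ⟩
    a′ + d       ≤⟨ +-monoʳ-≤ a′ d≤s+m ⟩
    a′ + (s + m) ≡⟨ cong (a′ +_) (+-comm s m) ⟩
    a′ + (m + s) ∎

module WireCount (n m : ℕ) (G : Circuit (n + m)) where
  open Circuit G
  open Mixed n m G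

  module Wires   = DoubleCount (inputs ∘ label) (not ∘ mixed)
  module Sources = DoubleCount (extVars n ∘ label) (λ (_ : Fin m) → true)

  -- Constants must be excluded: such a node is unmixed but contributes nothing on the left.
  label-balance : ∀ l → (∀ b → l ≢ const b) →
    Wires.total (inputs l) + Sources.total (extVars n l) + bit (inner l)
      ≡ bit (not (mixedLabel l)) + bit (isBin l)
  label-balance (var u) _ with splitAt n u
  ... | inj₁ _ = refl
  ... | inj₂ _ = refl
  label-balance (const b) nonconst = contradiction refl (nonconst b)
  label-balance (neg a) _ with mixed a
  ... | true  = refl
  ... | false = refl
  label-balance (bin _ a b) _ with mixed a | mixed b
  ... | true  | true  = refl
  ... | true  | false = refl
  ... | false | true  = refl
  ... | false | false = refl

  balance : (∀ i b → label i ≢ const b) →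
    sum (Wires.total ∘ inputs ∘ label) + sum (Sources.total ∘ extVars n ∘ label)
      + sum (bit ∘ inner ∘ label)
      ≡ sum (bit ∘ not ∘ mixed) + size
  balance nonconst = begin
    sum w + sum v + sum c           ≡⟨ cong (_+ sum c) (∑-distrib-+ w v) ⟨
    sum (λ p → w p + v p) + sum c   ≡⟨ ∑-distrib-+ (λ p → w p + v p) c ⟨
    sum (λ p → w p + v p + c p)     ≡⟨ sum-cong-≗ local ⟩
    sum (λ p → u p + b p)           ≡⟨ ∑-distrib-+ u b ⟩
    sum u + sum b                   ≡⟨ cong (sum u +_) size≡sum ⟨
    sum u + size                    ∎
    where
    open ≡-Reasoning
    w v c u b : Node → ℕ
    w = Wires.total ∘ inputs ∘ label
    v = Sources.total ∘ extVars n ∘ label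
    c = bit ∘ inner ∘ label
    u = bit ∘ not ∘ mixed
    b = bit ∘ isBin ∘ label
    size≡sum : size ≡ sum b
    size≡sum = trans (size≡ G) (∣tabulate∣≡sum (isBin ∘ label))
    local : ∀ p → w p + v p + c p ≡ u p + b p
    local p = trans (label-balance (label p) (nonconst p))
      (cong (λ x → bit (not x) + bit (isBin (label p))) (sym (mixed-label p)))

-- From optimality to tightness.

-- Collects everything that the construction of the trees takes from optimality.
record Tight (n m : ℕ) (G : Circuit (n + m)) : Set where
  open Circuit G
  open Mixed n m G
  field
    no-constants  : ∀ i b → label i ≢ const b
    connected     : ∀ i → i ◂* output
    mixed-output  : mixed output ≡ true
    source        : ∀ y → ∃ λ p → label p ≡ var (n ↑ʳ y)
    unique-wire   : ∀ {i} → mixed i ≡ false → (u w : ∃ λ p → i ◂ p) → u ≡ w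
    unique-source : ∀ {y p q} → label p ≡ var (n ↑ʳ y) → label q ≡ var (n ↑ʳ y) → p ≡ q

-- The base variable `v₀` has a source below the output, which is therefore mixed. This rules out
-- the constant circuit and gives each unmixed node an outgoing wire.
optimal⇒tight : ∀ n m → Fin n → (f : BoolFun n) (g : BoolFun (n + m)) → SimpleExtension {n} {m} f g →
                (G : Circuit (n + m)) → Optimal G g → Tight n m G
optimal⇒tight n m v₀ f g ext G opt = record
  { no-constants  = no-constants
  ; connected     = connected
  ; mixed-output  = mixed-output
  ; source        = λ y → source (n ↑ʳ y)
  ; unique-wire   = λ mi → Wires.tight⇒unique read (proj₁ tight) (cong not mi)
  ; unique-source = λ {y} p q → cong proj₁ (Sources.tight⇒unique listed
      (≤-trans (proj₂ tight) (≤-reflexive (sym (sum-ones m)))) {y} refl (_ , occurs p) (_ , occurs q))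
  }
  where
  open Circuit G
  open Mixed n m G
  open Optimal opt
  open Normalized normalized
  open SimpleExtension ext
  open WireCount n m G

  source : ∀ u → ∃ λ p → label p ≡ var u
  source u with x , differ ← nonDegenerate u = SourceExists.dependsOn⇒source G u
    (x , λ eq → differ (trans (sym (computes _)) (trans eq (computes _))))

  mixed-output : mixed output ≡ true
  mixed-output with p , eq ← source (v₀ ↑ˡ m) = mixed-mono (connected p)
    (trans (mixed-label p) (trans (cong mixedLabel eq) base))
    where
    base : mixedLabel (var (v₀ ↑ˡ m)) ≡ true
    base rewrite splitAt-↑ˡ n v₀ m = refl

  no-constants : ∀ i b → label i ≢ const b
  no-constants with constants
  ... | inj₁ none = none
  ... | inj₂ (_ , b , eq)
    with () ← trans (sym mixed-output) (trans (mixed-label output) (cong mixedLabel eq))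

  read : ∀ i → not (mixed i) ≡ true → ∃ λ p → i ◂ p
  read i mi with connected i
  ... | w ◅ _ = _ , w
  ... | ε with () ← trans (sym mi) (cong not mixed-output)

  occurs : ∀ {y p} → label p ≡ var (n ↑ʳ y) → y ∈ extVars n (label p)
  occurs {y} eq = subst (λ l → y ∈ extVars n l) (sym eq) (extVars-var n {N = nodes} y)

  listed : ∀ y → true ≡ true → ∃ λ p → y ∈ extVars n (label p)
  listed y _ with p , eq ← source (n ↑ʳ y) = p , occurs eq

  -- Restricting `G` to the key yields a circuit for `f` with no more binary gates than `G` has
  -- inner ones.
  inner≥CC : ∀ {s} → CC f s → s ≤ sum (bit ∘ inner ∘ label)
  inner≥CC (_ , lower) = ≤-trans
    (lower circuit λ x → trans (eval-restricted x) (trans (computes _) (restricts x)))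
    size-restricted
    where open Restriction key

  tight : sum (Wires.total ∘ inputs ∘ label) ≤ sum (bit ∘ not ∘ mixed)
        × sum (Sources.total ∘ extVars n ∘ label) ≤ m
  tight with s , CCf , ((C , C≡g , C-size) , _) ← complexity = squeeze
    (Wires.sum-bit≤sum-total read)
    (≤-trans (≤-reflexive (sym (sum-ones m))) (Sources.sum-bit≤sum-total listed))
    (inner≥CC CCf)
    -- `C` is a circuit for `g` of size `s + m`, so the minimal `G` is no larger.
    (≤-trans (proj₂ minimum C C≡g) (≤-reflexive C-size))
    (balance no-constants)

-- Reading off the trees.

module Decompose (n m : ℕ) (G : Circuit (n + m)) (tight : Tight n m G) where
  open Circuit G
  open Mixed n m G
  open YTree n m G
  open Tight tight

  -- The part of admissibility to be found by search: an unmixed root feeding a gate whose other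
  -- input is mixed. Tightness supplies the rest.
  record Combines (t : Triple) : Set where
    open Triple t
    field
      {op}     : BinOp
      {l r}    : Node
      combiner : label δ ≡ bin op l r
      root     : T ≡ (if b then r else l)
      unmixed  : mixed T ≡ false
      other    : mixed (if b then l else r) ≡ true

  mixed-input : ∀ {a p} → a ◂ p → mixed a ≡ true → mixed p ≡ true
  mixed-input w = mixed-mono (w ◅ ε)

  combines-root : ∀ {t} → Combines t → Triple.T t ◂ Triple.δ t
  combines-root {⟨ δ , false , _ ⟩} record { combiner = eq ; root = refl } =
    subst (λ l → _ ∈ inputs l) (sym eq) (here refl)
  combines-root {⟨ δ , true , _ ⟩}  record { combiner = eq ; root = refl } =
    subst (λ l → _ ∈ inputs l) (sym eq) (there (here refl))

  combines-mixed : ∀ {t} → Combines t → mixed (Triple.δ t) ≡ true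
  combines-mixed {⟨ δ , false , _ ⟩} record { combiner = eq ; other = o } =
    mixed-input (subst (λ l → _ ∈ inputs l) (sym eq) (there (here refl))) o
  combines-mixed {⟨ δ , true , _ ⟩}  record { combiner = eq ; other = o } =
    mixed-input (subst (λ l → _ ∈ inputs l) (sym eq) (here refl)) o

  unmixed-var : ∀ {i u} → mixed i ≡ false → label i ≡ var u → ∃ λ y → u ≡ n ↑ʳ y
  unmixed-var {i} {u} mi eq = go (trans (sym (trans (mixed-label i) (cong mixedLabel eq))) mi)
    where
    go : mixedLabel (var u) ≡ false → ∃ λ y → u ≡ n ↑ʳ y
    go mu with splitAt n u in split
    ... | inj₂ y = y , sym (splitAt⁻¹-↑ʳ split)

  -- All nodes below `T` are unmixed. Fan-out one and isolation both come from the uniqueness of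
  -- their outgoing wires, and read-once from the uniqueness of sources.
  combines⇒admissible : ∀ t → Combines t → Admissible t
  combines⇒admissible t C = record
    { combiner = combiner
    ; root     = root
    ; formula  = record
      { sources  = λ i s → sources i (unmixed-anti s unmixed)
      ; fan-out  = λ i u w s _ → unique-wire (unmixed-anti (proj₂ u ◅ s) unmixed) u w
      ; readOnce = readOnce
      }
    ; isolated = isolated
    ; base     = does⇒ (ReadsBase? _) other
    }
    where
    open Triple t
    open Combines C

    sources : ∀ i → mixed i ≡ false → inputs (label i) ≡ [] → ∃ λ y → label i ≡ var (n ↑ʳ y)
    sources i mi none with label i in eq
    ... | var u   = let y , u≡ = unmixed-var mi eq in y , cong var u≡
    ... | const b = contradiction eq (no-constants i b)

    readOnce : ∀ i j v → Sub T i → Sub T j → label i ≡ var v → label j ≡ var v → i ≡ j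
    readOnce i j v s _ i≡v j≡v with y , refl ← unmixed-var (unmixed-anti s unmixed) i≡v =
      unique-source i≡v j≡v

    isolated : Isolated T δ
    isolated i p ε p∉T w = cong proj₁ (unique-wire unmixed (p , w) (δ , combines-root C)) , refl
    -- The only wire out of a node strictly below `T` is the first one on its path to `T`, so its
    -- reader lies inside `T`.
    isolated i p (q ◅ s) p∉T w
      with refl ← unique-wire (unmixed-anti (q ◅ s) unmixed) (_ , q) (p , w) = contradiction s p∉T

  -- Upward paths from `i` through unmixed nodes are forced, so one root lies above the other. Each
  -- root is followed directly by a mixed gate, hence they coincide.
  combines-unique : ∀ {i t t′} → Combines t → Combines t′ →
                    i ◂* Triple.T t → i ◂* Triple.T t′ → t ≡ t′
  combines-unique {i} {t} {t′} C C′ = go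
    where
    open Triple t using (T)
    open Triple t′ using () renaming (T to T′)

    same-root : ∀ {t t′} → Combines t → Combines t′ → Triple.T t ≡ Triple.T t′ → t ≡ t′
    same-root {⟨ δ , b , T ⟩} {⟨ δ′ , b′ , T ⟩} C C′ refl
      with refl ← cong proj₁ (unique-wire (Combines.unmixed C)
                                (δ , combines-root C) (δ′ , combines-root C′)) =
      cong (λ b → ⟨ δ , b , T ⟩) (same-bit b b′ C C′)
      where
      same-bit : ∀ b b′ → Combines ⟨ δ , b , T ⟩ → Combines ⟨ δ , b′ , T ⟩ → b ≡ b′
      same-bit false false _ _ = refl
      same-bit true  true  _ _ = refl
      -- With opposite bits the root of one triple would be the other input of the second, hence
      -- both mixed and unmixed.
      same-bit false true record { combiner = eq ; other = o }
                          record { combiner = eq′ ; root = T≡ ; unmixed = u }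
        with refl ← trans (sym eq) eq′ with () ← trans (sym o) (trans (cong mixed (sym T≡)) u)
      same-bit true false record { combiner = eq ; other = o }
                          record { combiner = eq′ ; root = T≡ ; unmixed = u }
        with refl ← trans (sym eq) eq′ with () ← trans (sym o) (trans (cong mixed (sym T≡)) u)

    -- The wire leaving T enters the mixed gate δ, and no unmixed node is above δ.
    stops : ∀ {t p} → Combines t → mixed p ≡ false → Triple.T t ◂* p → Triple.T t ≡ p
    stops C mp ε = refl
    stops {t} C mp (w ◅ s)
      with refl ← unique-wire (Combines.unmixed C) (Triple.δ t , combines-root C) (_ , w)
      with () ← trans (sym (combines-mixed C)) (unmixed-anti s mp)

    go : ∀ {i} → i ◂* T → i ◂* T′ → t ≡ t′
    go ε s = same-root C C′ (stops C (Combines.unmixed C′) s)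
    go s ε = same-root C C′ (sym (stops C′ (Combines.unmixed C) s))
    go (w ◅ s) (w′ ◅ s′)
      with refl ← unique-wire (unmixed-anti (w ◅ s) (Combines.unmixed C)) (_ , w) (_ , w′) = go s s′

  -- The path from `i` to the output ends at a mixed node; the last node before the first mixed one
  -- is the root of the tree.
  first-combiner : ∀ {i} → mixed i ≡ false → ∃ λ t → Combines t × i ◂* Triple.T t
  first-combiner {i} mi = go (connected i) mi
    where
    -- A negation is mixed exactly when its input is, so the first mixed node is binary and its
    -- other input has to be mixed.
    enter : ∀ {i j} l → label j ≡ l → i ∈ inputs l → mixed i ≡ false →
            mixedLabel l ≡ true → ∃ λ t → Combines t × Triple.T t ≡ i
    enter (neg a) eq (here refl) mi ml with () ← trans (sym mi) ml
    enter {j = j} (bin op a b) eq (here refl) mi ml rewrite mi =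
      ⟨ j , false , a ⟩ , record { combiner = eq ; root = refl ; unmixed = mi ; other = ml } , refl
    enter {j = j} (bin op a b) eq (there (here refl)) mi ml rewrite mi =
      ⟨ j , true , b ⟩ ,
      record { combiner = eq ; root = refl ; unmixed = mi
             ; other = trans (sym (∨-identityʳ (mixed a))) ml } , refl

    go : ∀ {i} → i ◂* output → mixed i ≡ false → ∃ λ t → Combines t × i ◂* Triple.T t
    go ε mi with () ← trans (sym mi) mixed-output
    go (_◅_ {j = j} w s) mi = by-mixed (mixed j) refl
      where
      by-mixed : ∀ b → mixed j ≡ b → ∃ λ t → Combines t × _ ◂* Triple.T t
      by-mixed false mj with t , C , s′ ← go s mj = t , C , w ◅ s′
      by-mixed true  mj
        with t , C , refl ← enter (label j) refl w mi (trans (sym (mixed-label j)) mj) =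
        t , C , ε

  unmixed-source : ∀ {p y} → label p ≡ var (n ↑ʳ y) → mixed p ≡ false
  unmixed-source {p} {y} eq = trans (mixed-label p) (trans (cong mixedLabel eq) ext)
    where
    ext : mixedLabel (var (n ↑ʳ y)) ≡ false
    ext rewrite splitAt-↑ʳ n m y = refl

  tripleAbove : ∀ y → ∃ λ t → Combines t × proj₁ (source y) ◂* Triple.T t
  tripleAbove y = first-combiner (unmixed-source (proj₂ (source y)))

  all-combine : ∀ {t} → t ∈ List.tabulate (proj₁ ∘ tripleAbove) → Combines t
  all-combine t∈ with y , refl ← ∈-tabulate⁻ t∈ = proj₁ (proj₂ (tripleAbove y))

  decomposition : Decomposition
  decomposition = record
    -- One triple per extension variable. Variables of the same tree repeat the same triple, which
    -- is harmless as the list stands for a set.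
    { triples         = List.tabulate (proj₁ ∘ tripleAbove)
    ; admissible      = λ t t∈ → combines⇒admissible t (all-combine t∈)
    ; nonIntersecting = nonIntersecting
    }
    where
    nonIntersecting : ∀ y t t′ → t ∈ List.tabulate (proj₁ ∘ tripleAbove) →
      t′ ∈ List.tabulate (proj₁ ∘ tripleAbove) →
      ReadsExt (Triple.T t) y → ReadsExt (Triple.T t′) y → t ≡ t′
    nonIntersecting y t t′ t∈ t′∈ (i , s , i≡y) (i′ , s′ , i′≡y)
      with refl ← unique-source i≡y i′≡y = combines-unique (all-combine t∈) (all-combine t′∈) s s′

  total : Total decomposition
  total y with tripleAbove y in eq
  ... | t , _ , s =
    t , subst (_∈ _) (cong proj₁ eq) (∈-tabulate⁺ y) , proj₁ (source y) , s , proj₂ (source y)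

mainTheorem5 : ∀ (n m : ℕ) .{{_ : NonZero n}} (f : BoolFun n) → NonDegenerate f →
    ∀ (g : BoolFun (n + m)) → SimpleExtension {n} {m} f g →
    ∀ (G : Circuit (n + m)) → Optimal G g →
    ∃ λ (D : YTree.Decomposition n m G) → YTree.Total n m G D
-- Since `n` is nonzero, `zero` serves as the base variable that makes the output mixed.
mainTheorem5 n@(suc _) m f _ g ext G opt =
  decomposition , total
  where open Decompose n m G (optimal⇒tight n m zero f g ext G opt)
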